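{- For every $\epsilon>0$ and every positive integer $\ell$, there is a constant $c=c(\ell,\epsilon)>0$ such that for every $N$, every coloring of the $3$-element subsets (triples) of an $N$-element set with $\ell$ colors contains a subset $S$ of size $s=c\sqrt{\log N}$ such that at least $(1-\epsilon)\binom{s}{3}$ triples of $S$ have the same color.
   Context: All logarithms are in base $2$. Floor and ceiling signs are omitted where not crucial. -}

module Defs where

open import Data.Nat using (ℕ)
open import Data.Fin using (Fin; _<?_; _<_)
open import Data.Fin.Subset using (Subset; _∈_)
open import Data.Fin.Subset.Properties using (_∈?_)
open import Data.List using (List; allFin; concatMap; filter; length; _∷_; [])
open import Data.Product using (_×_; _,_)
open import Relation.Nullary using (Dec; yes; no)
open import Relation.Nullary.Decidable using (_×-dec_)
open import Relation.Binary.PropositionalEquality using (_≡_)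

-- A colouring of the 3-element subsets of Fin N with ℓ colours.
-- A triple {i,j,k} with i < j < k receives colour χ i j k; the values of χ
-- on non-increasing argument lists are irrelevant.
TripleColouring : ℕ → ℕ → Set
TripleColouring N ℓ = Fin N → Fin N → Fin N → Fin ℓ

triplesOf : {N : ℕ} → Subset N → List (Fin N × Fin N × Fin N)
triplesOf {N} S =
  concatMap (λ i → concatMap (λ j → concatMap (λ k →
      keep i j k) (allFin N)) (allFin N)) (allFin N)
  where
  keep : Fin N → Fin N → Fin N → List (Fin N × Fin N × Fin N)
  keep i j k with (i ∈? S) ×-dec (j ∈? S) ×-dec (k ∈? S) ×-dec (i <? j) ×-dec (j <? k)
  ... | yes _ = (i , j , k) ∷ []
  ... | no _  = []

countColour : {N ℓ : ℕ} → TripleColouring N ℓ → Subset N → Fin ℓ → ℕ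
countColour {ℓ = ℓ} χ S col =
  length (filter (λ { (i , j , k) → χ i j k Data.Fin.≟ col }) (triplesOf S))

{-# OPTIONS --safe #-}

-- Put R ordered parts of 2^O(s²) vertices each into the vertex set and treat the parts one at a
-- time. When the parts already treated have kept O(s) vertices each, take 2^O(s) candidates from
-- the next part. Every remaining vertex colours the (candidate, kept vertex) pairs, and by
-- pigeonhole it has a homogeneous sub-box with O(s) vertices from each part. There are only
-- 2^O(s²) boxes, so a 2^-O(s²) fraction of the remaining vertices share one, colours included.
-- In the end R parts with s vertices each are left in which the colour of a transversal triple
-- depends only on its three parts. If R is a Ramsey number, some r parts are monochromatic, and
-- among s vertices spread evenly over r parts at most 2s³/r triples are not transversal.
module Submission where

open import Defs
open import Data.Nat as ℕ using (ℕ; zero; suc; _+_; _*_; _∸_; _^_; _≤_; _<_; z≤n; s≤s; _/_; _%_; NonZero)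
import Data.Nat.Properties as ℕ
open import Data.Nat.Combinatorics using (_C_; nC1≡n; nCk+nC[k+1]≡[n+1]C[k+1])
open import Data.Nat.DivMod using (m%n<n; m≡m%n+[m/n]*n; m/n*n≤m; m<n*o⇒m/o<n; /-monoˡ-≤)
open import Data.Nat.Tactic.RingSolver using (solve-∀)
open import Data.Fin as Fin using (Fin; zero; suc; toℕ; fromℕ<; inject≤; combine; quotient; remainder; funToFin; finToFun)
import Data.Fin.Properties as Fin
open import Data.Fin.Subset using (Subset; inside; outside; ⊥; ∣_∣; _∈_; _∉_)
open import Data.Fin.Subset.Properties using (∣⊥∣≡0; ∉⊥; _∈?_)
open import Data.Vec using (_∷_; _[_]≔_; here; there)
open import Data.Vec.Properties using ([]≔-updates; []≔-minimal; lookup∘update′; lookup⇒[]=; []=⇒lookup)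
open import Data.List using (List; []; _∷_; _++_; map; length; filter; lookup; allFin; upTo; concatMap; foldr)
open import Data.List.Properties using (length-tabulate; length-map; length-++; filter-++; length-filter; filter-none; filter-accept; filter-reject; length-upTo)
open import Data.List.Membership.Propositional using (lose) renaming (_∈_ to _∈ᴸ_)
open import Data.List.Membership.Propositional.Properties using (∈-lookup; ∈-∃++; ∈-++⁻; ∈-++⁺ˡ; ∈-++⁺ʳ; ∈-map⁺; ∈-allFin; ∈-upTo⁺; ∈-filter⁺; ∈-concatMap⁺)
open import Data.List.Relation.Binary.Sublist.Propositional using (_⊆_; []; _∷_; _∷ʳ_; ⊆-refl; ⊆-trans; minimum)
open import Data.List.Relation.Binary.Sublist.Propositional.Properties using (All-resp-⊆; filter-⊆; map⁺)
open import Data.List.Relation.Unary.All as All using (All; []; _∷_)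
import Data.List.Relation.Unary.All.Properties as All
open import Data.List.Relation.Unary.AllPairs as AllPairs using (AllPairs; []; _∷_)
import Data.List.Relation.Unary.AllPairs.Properties as AllPairs
open import Data.List.Relation.Unary.Any using (here; there)
open import Data.List.Relation.Unary.Unique.Propositional using (Unique)
import Data.List.Relation.Unary.Unique.Propositional.Properties as Unique
open import Data.Product using (Σ; _×_; _,_; proj₁; proj₂; ∃-syntax)
open import Data.Product.Properties using (,-injectiveˡ; ,-injectiveʳ)
open import Data.Sum using (inj₁; inj₂)
open import Data.Unit using (⊤; tt)
open import Function using (_∘_; id)
open import Level using (0ℓ)
open import Relation.Binary using (Rel; tri<; tri≈; tri>)
open import Relation.Binary.PropositionalEquality using (_≡_; _≢_; refl; sym; trans; cong; cong₂; subst; subst₂; module ≡-Reasoning)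
open import Relation.Nullary using (yes; no; contradiction; ¬?)
open import Relation.Nullary.Decidable using (_×-dec_)
open import Relation.Unary using (Pred; Decidable)

-- Pigeonhole principles

length-filter-split : ∀ {A : Set} {P : Pred A 0ℓ} (P? : Decidable P) xs →
  length xs ≡ length (filter P? xs) + length (filter (¬? ∘ P?) xs)
length-filter-split P? [] = refl
length-filter-split P? (x ∷ xs) with P? x
... | yes _ = cong suc (length-filter-split P? xs)
... | no  _ = trans (cong suc (length-filter-split P? xs)) (sym (ℕ.+-suc _ _))

AllPairs-resp-⊆ : ∀ {A : Set} {R : Rel A 0ℓ} {xs ys} → xs ⊆ ys → AllPairs R ys → AllPairs R xs
AllPairs-resp-⊆ []         []       = []
AllPairs-resp-⊆ (_ ∷ʳ p)   (_ ∷ rs) = AllPairs-resp-⊆ p rs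
AllPairs-resp-⊆ (refl ∷ p) (r ∷ rs) = All-resp-⊆ p r ∷ AllPairs-resp-⊆ p rs

AllPairs-lookup : ∀ {A : Set} {R : Rel A 0ℓ} {xs} → AllPairs R xs →
  ∀ {i j} → i Fin.< j → R (lookup xs i) (lookup xs j)
AllPairs-lookup (r ∷ rs) {zero}  {suc j} _         = All.lookup r (∈-lookup j)
AllPairs-lookup (r ∷ rs) {suc i} {suc j} (s≤s i<j) = AllPairs-lookup rs i<j

-- Induction on the number of colours still possible: either the largest one already has more than
-- `M` entries, or discarding its class costs one colour and at most `M` entries.
pigeonhole-list-below : ∀ {A : Set} {K} (f : A → Fin K) {M} k → k ≤ K → ∀ xs →
  All (λ x → toℕ (f x) < k) xs → k * M < length xs →
  ∃[ c ] ∃[ ys ] (ys ⊆ xs × M < length ys × All (λ y → f y ≡ c) ys)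
pigeonhole-list-below f zero k≤K (x ∷ xs) (() ∷ _) lt
pigeonhole-list-below {K = K} f {M} (suc k) k<K xs <1+k lt
  with M ℕ.<? length (filter (λ x → f x Fin.≟ fromℕ< k<K) xs)
... | yes M< = fromℕ< k<K , _ , filter-⊆ _ xs , M< , All.all-filter _ xs
... | no  M≮ with pigeonhole-list-below f {M} k (ℕ.<⇒≤ k<K) rest rest<k rest>
  where
  P? = λ x → f x Fin.≟ fromℕ< k<K
  rest = filter (¬? ∘ P?) xs
  rest<k : All (λ x → toℕ (f x) < k) rest
  rest<k = All.zipWith
    (λ { {x} (f<1+k , f≢k) → ℕ.≤∧≢⇒< (ℕ.s≤s⁻¹ f<1+k)
           (λ eq → f≢k (Fin.toℕ-injective (trans eq (sym (Fin.toℕ-fromℕ< k<K))))) })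
    (All.filter⁺ (¬? ∘ P?) <1+k , All.all-filter (¬? ∘ P?) xs)
  rest> : k * M < length rest
  rest> = ℕ.+-cancelˡ-< M _ _ (begin-strict
    M + k * M ≡⟨⟩
    suc k * M <⟨ lt ⟩
    length xs ≡⟨ length-filter-split P? xs ⟩
    length (filter P? xs) + length rest ≤⟨ ℕ.+-monoˡ-≤ _ (ℕ.≮⇒≥ M≮) ⟩
    M + length rest ∎)
    where open ℕ.≤-Reasoning
... | c , ys , ys⊆ , M< , mono = c , ys , ⊆-trans ys⊆ (filter-⊆ _ xs) , M< , mono

pigeonhole-list : ∀ {A : Set} {K M} (f : A → Fin K) xs → K * M < length xs →
  ∃[ c ] ∃[ ys ] (ys ⊆ xs × M < length ys × All (λ y → f y ≡ c) ys)
pigeonhole-list {K = K} f xs = pigeonhole-list-below f K ℕ.≤-refl xs (All.universal (Fin.toℕ<n ∘ f) xs)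

Increasing : ∀ {m n} → (Fin m → Fin n) → Set
Increasing f = ∀ {x y} → x Fin.< y → f x Fin.< f y

inject≤-increasing : ∀ {m n} .(m≤n : m ≤ n) → Increasing (λ i → inject≤ i m≤n)
inject≤-increasing m≤n {x} {y} x<y =
  subst₂ _<_ (sym (Fin.toℕ-inject≤ x m≤n)) (sym (Fin.toℕ-inject≤ y m≤n)) x<y

allFin-increasing : ∀ n → AllPairs Fin._<_ (allFin n)
allFin-increasing n = AllPairs.tabulate⁺-< id

-- A sublist of `allFin n` inherits its order, so reading its first `M` entries by position gives an
-- increasing map.
pigeonhole-increasing : ∀ {n K M} (f : Fin n → Fin K) → K * M < n →
  ∃[ c ] Σ (Fin M → Fin n) λ g → Increasing g × (∀ x → f (g x) ≡ c)
pigeonhole-increasing {n} {K} {M} f lt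
  with c , ys , ys⊆ , M< , mono ←
         pigeonhole-list f (allFin n) (subst (K * M <_) (sym (length-tabulate id)) lt) =
  c , (λ x → lookup ys (ι x))
    , (λ x<y → AllPairs-lookup (AllPairs-resp-⊆ ys⊆ (allFin-increasing n))
                 (inject≤-increasing (ℕ.<⇒≤ M<) x<y))
    , (λ x → All.lookup mono (∈-lookup (ι x)))
  where
  ι : Fin M → Fin (length ys)
  ι x = inject≤ x (ℕ.<⇒≤ M<)

-- Ramsey's theorem

Colouring : Set → ℕ → ℕ → Set
Colouring A ℓ zero    = Fin ℓ
Colouring A ℓ (suc k) = A → Colouring A ℓ k

module _ {A : Set} {ℓ : ℕ} where

  -- Recursion along the list evaluates `f` only on tuples in list order, so no symmetry of the
  -- colouring is involved.
  Mono : ∀ k → Colouring A ℓ k → Fin ℓ → List A → Set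
  Mono zero    f c _        = f ≡ c
  Mono (suc k) f c []       = ⊤
  Mono (suc k) f c (x ∷ xs) = Mono k (f x) c xs × Mono (suc k) f c xs

  Mono-resp-⊆ : ∀ k {f c xs ys} → xs ⊆ ys → Mono k f c ys → Mono k f c xs
  Mono-resp-⊆ zero    _          m       = m
  Mono-resp-⊆ (suc k) []         m       = tt
  Mono-resp-⊆ (suc k) (_ ∷ʳ p)   (_ , m) = Mono-resp-⊆ (suc k) p m
  Mono-resp-⊆ (suc k) (refl ∷ p) (h , m) = Mono-resp-⊆ k p h , Mono-resp-⊆ (suc k) p m

  -- Min-homogeneity: the colour of a tuple depends only on its first entry, and is stored next to
  -- that entry.
  EndMono : ∀ k → Colouring A ℓ (suc k) → List (A × Fin ℓ) → Set
  EndMono k f []             = ⊤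
  EndMono k f ((x , c) ∷ ps) = Mono k (f x) c (map proj₁ ps) × EndMono k f ps

  EndMono-resp-⊆ : ∀ k {f ps qs} → ps ⊆ qs → EndMono k f qs → EndMono k f ps
  EndMono-resp-⊆ k []         m       = tt
  EndMono-resp-⊆ k (_ ∷ʳ p)   (_ , m) = EndMono-resp-⊆ k p m
  EndMono-resp-⊆ k (refl ∷ p) (h , m) = Mono-resp-⊆ k (map⁺ proj₁ p) h , EndMono-resp-⊆ k p m

  EndMono⇒Mono : ∀ k {f c} ps → All (λ p → proj₂ p ≡ c) ps → EndMono k f ps →
    Mono (suc k) f c (map proj₁ ps)
  EndMono⇒Mono k []       _           _       = tt
  EndMono⇒Mono k (_ ∷ ps) (refl ∷ es) (h , m) = h , EndMono⇒Mono k ps es m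

IsRamsey : (ℓ k n R : ℕ) → Set₁
IsRamsey ℓ k n R = ∀ {A : Set} (f : Colouring A ℓ k) xs → R ≤ length xs →
  ∃[ c ] ∃[ ys ] (ys ⊆ xs × n ≤ length ys × Mono k f c ys)

-- For arity `suc k`, find a min-homogeneous list with more than `ℓ * n` entries; by pigeonhole more
-- than `n` of them store the same colour.
ramsey : ∀ ℓ k n → ∃[ R ] IsRamsey ℓ k n R
-- Fix the head `x`, apply `ramsey` for arity `k` to `f x` on the tail, and continue inside the
-- monochromatic sublist.
endRamsey : ∀ ℓ k n → ∃[ R ] ∀ {A : Set} (f : Colouring A ℓ (suc k)) xs → R ≤ length xs →
  ∃[ ps ] (map proj₁ ps ⊆ xs × n ≤ length ps × EndMono k f ps)

ramsey ℓ zero    n = n , λ f xs n≤ → f , xs , ⊆-refl , n≤ , refl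
ramsey ℓ (suc k) n with R , end ← endRamsey ℓ k (suc (ℓ * n)) = R , go
  where
  go : IsRamsey ℓ (suc k) n R
  go f xs R≤
    with ps , ps⊆ , long , m ← end f xs R≤
    with c , qs , qs⊆ , n< , eqs ← pigeonhole-list proj₂ ps long =
    c , map proj₁ qs , ⊆-trans (map⁺ proj₁ qs⊆) ps⊆
      , subst (n ≤_) (sym (length-map proj₁ qs)) (ℕ.<⇒≤ n<)
      , EndMono⇒Mono k qs eqs (EndMono-resp-⊆ k qs⊆ m)

endRamsey ℓ k zero = 0 , λ f xs _ → [] , minimum xs , z≤n , tt
endRamsey ℓ k (suc n) with R , end ← endRamsey ℓ k n with R′ , ram ← ramsey ℓ k R = suc R′ , go
  where
  go : ∀ {A : Set} (f : Colouring A ℓ (suc k)) xs → suc R′ ≤ length xs →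
    ∃[ ps ] (map proj₁ ps ⊆ xs × suc n ≤ length ps × EndMono k f ps)
  go f (x ∷ xs) (s≤s R′≤)
    with c , ys , ys⊆ , R≤ , m ← ram (f x) xs R′≤
    with ps , ps⊆ , n≤ , e ← end f ys R≤ =
    (x , c) ∷ ps , refl ∷ ⊆-trans ps⊆ ys⊆ , s≤s n≤ , Mono-resp-⊆ k ps⊆ m , e

-- Homogeneous boxes and blow-ups

-- Pure data, with the proofs kept apart in `Homogeneous`, so that boxes can be encoded in a finite
-- set and counted.
record Box (j m′ m M L : ℕ) : Set where
  field
    rows : Fin m′ → Fin M
    cols : Fin j → Fin m′ → Fin m
    col  : Fin j → Fin L

open Box

record Homogeneous {j m′ m M L} (g : Fin M → Fin j → Fin m → Fin L) (b : Box j m′ m M L) : Set where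
  field
    rows-inc : Increasing (rows b)
    cols-inc : ∀ i → Increasing (cols b i)
    constant : ∀ y i x → g (rows b y) i (cols b i x) ≡ col b i

open Homogeneous

-- There are `(L ^ m) ^ j` possible rows of colours, so `m′` candidates share one. That common row
-- colours each kept part with `L` colours, and a second pigeonhole in each part picks the columns.
find-box : ∀ {j m′ m M L} (g : Fin M → Fin j → Fin m → Fin L) →
  (L ^ m) ^ j * m′ < M → L * m′ < m → ∃[ b ] Homogeneous {m′ = m′} g b
find-box {j} {m′} {m} {M} {L} g many-rows many-cols
  with w , B , B-inc , B-mono ← pigeonhole-increasing (λ y → funToFin (λ i → funToFin (g y i))) many-rows =
  record { rows = B ; cols = λ i → proj₁ (proj₂ (columns i)) ; col = λ i → proj₁ (columns i) } ,
  record { rows-inc = B-inc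
         ; cols-inc = λ i → proj₁ (proj₂ (proj₂ (columns i)))
         ; constant = λ y i x → trans (same-row y i _) (proj₂ (proj₂ (proj₂ (columns i))) x) }
  where
  pattern-of : Fin j → Fin m → Fin L
  pattern-of i = finToFun (finToFun w i)
  same-row : ∀ y i x → g (B y) i x ≡ pattern-of i x
  same-row y i x = begin
    g (B y) i x ≡⟨ Fin.finToFun-funToFin (g (B y) i) x ⟨
    finToFun (funToFin (g (B y) i)) x
      ≡⟨ cong (λ v → finToFun v x) (Fin.finToFun-funToFin (λ i′ → funToFin (g (B y) i′)) i) ⟨
    finToFun (finToFun (funToFin (λ i′ → funToFin (g (B y) i′))) i) x
      ≡⟨ cong (λ v → finToFun (finToFun v i) x) (B-mono y) ⟩
    pattern-of i x ∎
    where open ≡-Reasoning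
  columns : ∀ i → ∃[ e ] Σ (Fin m′ → Fin m) λ C → Increasing C × (∀ x → pattern-of i (C x) ≡ e)
  columns i = pigeonhole-increasing (pattern-of i) many-cols

boxes : (j m′ m M L : ℕ) → ℕ
boxes j m′ m M L = M ^ m′ * ((m ^ m′) ^ j * L ^ j)

encode : ∀ {j m′ m M L} → Box j m′ m M L → Fin (boxes j m′ m M L)
encode b = combine (funToFin (rows b)) (combine (funToFin (λ i → funToFin (cols b i))) (funToFin (col b)))

decode : ∀ {j m′ m M L} → Fin (boxes j m′ m M L) → Box j m′ m M L
decode {j} {m′} {m} {M} {L} d = record
  { rows = finToFun (quotient ((m ^ m′) ^ j * L ^ j) d)
  ; cols = λ i → finToFun (finToFun (quotient (L ^ j) (remainder {M ^ m′} ((m ^ m′) ^ j * L ^ j) d)) i)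
  ; col  = finToFun (remainder {(m ^ m′) ^ j} (L ^ j) (remainder {M ^ m′} ((m ^ m′) ^ j * L ^ j) d)) }

module _ {j m′ m M L} (b : Box j m′ m M L) where

  recoded : Box j m′ m M L
  recoded = decode {j} {m′} {m} {M} {L} (encode b)

  decode-rows : ∀ y → rows recoded y ≡ rows b y
  decode-rows y = trans
    (cong (λ p → finToFun (proj₁ p) y)
      (Fin.remQuot-combine {M ^ m′} {(m ^ m′) ^ j * L ^ j} (funToFin (rows b)) _))
    (Fin.finToFun-funToFin (rows b) y)

  decode-rest : remainder {M ^ m′} _ (encode b) ≡ combine (funToFin (λ i → funToFin (cols b i))) (funToFin (col b))
  decode-rest = cong proj₂ (Fin.remQuot-combine {M ^ m′} {(m ^ m′) ^ j * L ^ j} (funToFin (rows b)) _)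

  decode-cols : ∀ i x → cols recoded i x ≡ cols b i x
  decode-cols i x = trans
    (cong (λ v → finToFun (finToFun v i) x)
      (trans (cong (quotient _) decode-rest)
             (cong proj₁ (Fin.remQuot-combine {(m ^ m′) ^ j} _ (funToFin (col b))))))
    (trans (cong (λ v → finToFun v x) (Fin.finToFun-funToFin (λ i → funToFin (cols b i)) i))
      (Fin.finToFun-funToFin (cols b i) x))

  decode-col : ∀ i → col recoded i ≡ col b i
  decode-col i = trans
    (cong (λ v → finToFun v i)
      (trans (cong (remainder {(m ^ m′) ^ j} _) decode-rest) (cong proj₂ (Fin.remQuot-combine {(m ^ m′) ^ j} _ (funToFin (col b))))))
    (Fin.finToFun-funToFin (col b) i)

  -- Decoding returns the maps of `b` only up to pointwise equality, so homogeneity is transported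
  -- by hand.
  decode-homogeneous : ∀ {g} → Homogeneous g b → Homogeneous g recoded
  decode-homogeneous {g} hom = record
    { rows-inc = λ {x} {y} x<y →
        subst₂ Fin._<_ (sym (decode-rows x)) (sym (decode-rows y)) (rows-inc hom x<y)
    ; cols-inc = λ i {x} {y} x<y →
        subst₂ Fin._<_ (sym (decode-cols i x)) (sym (decode-cols i y)) (cols-inc hom i x<y)
    ; constant = λ y i x → trans (cong₂ (λ r c → g r i c) (decode-rows y) (decode-cols i x))
                             (trans (constant hom y i x) (sym (decode-col i))) }

-- Pigeonhole over the codes of the boxes that `find-box` gives for the individual pool elements.
common-box : ∀ {j m′ m M L p p′} (g : Fin p → Fin M → Fin j → Fin m → Fin L) →
  (L ^ m) ^ j * m′ < M → L * m′ < m → boxes j m′ m M L * p′ < p →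
  Σ (Box j m′ m M L) λ b → Σ (Fin p′ → Fin p) λ h → Increasing h × (∀ t → Homogeneous (g (h t)) b)
common-box {j} {m′} {m} {M} {L} g many-rows many-cols many
  with d , h , h-inc , h-mono ← pigeonhole-increasing (λ t → encode (proj₁ (find-box (g t) many-rows many-cols)))
                               many =
  decode d , h , h-inc , λ t →
  subst (λ v → Homogeneous (g (h t)) (decode {j} {m′} {m} {M} {L} v)) (h-mono t)
    (decode-homogeneous _ (proj₂ (find-box (g (h t)) many-rows many-cols)))

PartiteColouring : ℕ → ℕ → ℕ → Set
PartiteColouring R n ℓ = Fin R → Fin n → Fin R → Fin n → Fin R → Fin n → Fin ℓ

-- A pool element t stands for the vertex t of every part at once, so that one pigeonhole shrinks
-- all remaining parts simultaneously. Treated parts are consed in front of each other: the pool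
-- supplies the smallest vertex of a triple, and the parts are treated from the last to the first.
record Blowup {R n ℓ j} (c : PartiteColouring R n ℓ) (q : Fin j → Fin R) (m p : ℕ) : Set where
  field
    part      : Fin j → Fin m → Fin n
    part-inc  : ∀ i → Increasing (part i)
    pool      : Fin p → Fin n
    pool-inc  : Increasing pool
    φ         : Fin R → Fin j → Fin j → Fin ℓ
    pool-mono : ∀ k t {i i′} → i Fin.< i′ → ∀ x y →
                c k (pool t) (q i) (part i x) (q i′) (part i′ y) ≡ φ k i i′
    part-mono : ∀ {i i′ i″} → i Fin.< i′ → i′ Fin.< i″ → ∀ x y z →
                c (q i) (part i x) (q i′) (part i′ y) (q i″) (part i″ z) ≡ φ (q i) i′ i″

-- The first `M` pool elements are the candidates for the new part. The common box settles triples
-- of a pool, a new and a kept vertex; triples that start in the new part start at an old pool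
-- element and are settled by `pool-mono`.
extend : ∀ {R n ℓ j m m′ M p p′} {c : PartiteColouring R n ℓ} {q : Fin (suc j) → Fin R} →
  Fin ℓ → Fin p′ →
  ((ℓ ^ R) ^ m) ^ j * m′ < M → ℓ ^ R * m′ < m → M ≤ p → boxes j m′ m M (ℓ ^ R) * p′ < p →
  Blowup c (q ∘ suc) m p → Blowup c q m′ p′
extend {R} {n} {ℓ} {j} {m} {m′} {M} {p} {p′} {c} {q} c₀ t₀ many-rows many-cols M≤p many B =
  go (common-box g many-rows many-cols many)
  where
  open Blowup B
  row : Fin M → Fin n
  row y = pool (inject≤ y M≤p)
  colours : Fin p → Fin M → Fin j → Fin m → Fin R → Fin ℓ
  colours t y i x k = c k (pool t) (q zero) (row y) (q (suc i)) (part i x)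
  -- The pool element may end up in any part `k`, so its colours for all `k` are packed into one of
  -- `ℓ ^ R` values.
  g : Fin p → Fin M → Fin j → Fin m → Fin (ℓ ^ R)
  g t y i x = funToFin (colours t y i x)
  go : (Σ (Box j m′ m M (ℓ ^ R)) λ b → Σ (Fin p′ → Fin p) λ h →
        Increasing h × (∀ t → Homogeneous (g (h t)) b)) →
       Blowup c q m′ p′
  go (b , h , h-inc , hom) = record
    { part      = part′
    ; part-inc  = part′-inc
    ; pool      = pool ∘ h
    ; pool-inc  = pool-inc ∘ h-inc
    ; φ         = φ′
    ; pool-mono = pool-mono′
    ; part-mono = part-mono′
    }
    where
    part′ : Fin (suc j) → Fin m′ → Fin n
    part′ zero    y = row (rows b y)
    part′ (suc i) x = part i (cols b i x)
    part′-inc : ∀ i → Increasing (part′ i)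
    -- Monotonicity of the box comes with its homogeneity for some pool element, so one element `t₀`
    -- has to exist.
    part′-inc zero    = pool-inc ∘ inject≤-increasing M≤p ∘ rows-inc (hom t₀)
    part′-inc (suc i) = part-inc i ∘ cols-inc (hom t₀) i
    φ′ : Fin R → Fin (suc j) → Fin (suc j) → Fin ℓ
    φ′ k zero    (suc i) = finToFun (col b i) k
    φ′ k (suc i) (suc i′) = φ k i i′
    -- A filler: the properties below use a last index larger than the one before it, hence never
    -- `zero`.
    φ′ k _       zero    = c₀
    pool-mono′ : ∀ k t {i i′} → i Fin.< i′ → ∀ x y →
                c k (pool (h t)) (q i) (part′ i x) (q i′) (part′ i′ y) ≡ φ′ k i i′
    pool-mono′ k t {zero} {suc i′} _ x y =
      trans (sym (Fin.finToFun-funToFin (colours (h t) (rows b x) i′ (cols b i′ y)) k))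
            (cong (λ v → finToFun v k) (constant (hom t) x i′ y))
    pool-mono′ k t {suc i} {suc i′} (s≤s i<i′) x y = pool-mono k (h t) i<i′ _ _
    part-mono′ : ∀ {i i′ i″} → i Fin.< i′ → i′ Fin.< i″ → ∀ x y z →
                c (q i) (part′ i x) (q i′) (part′ i′ y) (q i″) (part′ i″ z) ≡ φ′ (q i) i′ i″
    part-mono′ {zero}  {suc i′} {suc i″} _ (s≤s i′<i″) x y z = pool-mono (q zero) _ i′<i″ _ _
    part-mono′ {suc i} {suc i′} {suc i″} (s≤s i<i′) (s≤s i′<i″) x y z = part-mono i<i′ i′<i″ _ _ _

-- Quantitative bounds

n≤2^n : ∀ n → n ≤ 2 ^ n
1+x≤2^1+e : ∀ {x} e → x ≤ 2 ^ e → suc x ≤ 2 ^ suc e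

1+x≤2^1+e {x} e x≤ = begin
  suc x         ≤⟨ ℕ.+-mono-≤ (ℕ.m^n>0 2 e) x≤ ⟩
  2 ^ e + 2 ^ e ≡⟨ cong (2 ^ e +_) (ℕ.+-identityʳ (2 ^ e)) ⟨
  2 ^ suc e     ∎
  where open ℕ.≤-Reasoning

n≤2^n zero    = z≤n
n≤2^n (suc n) = 1+x≤2^1+e n (n≤2^n n)

*-≤2^ : ∀ {x y} d e → x ≤ 2 ^ d → y ≤ 2 ^ e → x * y ≤ 2 ^ (d + e)
*-≤2^ {x} {y} d e x≤ y≤ = subst (x * y ≤_) (sym (ℕ.^-distribˡ-+-* 2 d e)) (ℕ.*-mono-≤ x≤ y≤)

^-≤2^ : ∀ {x} d n → x ≤ 2 ^ d → x ^ n ≤ 2 ^ (d * n)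
^-≤2^ {x} d n x≤ = subst (x ^ n ≤_) (ℕ.^-*-assoc 2 d n) (ℕ.^-monoˡ-≤ n x≤)

-- The parameters of one extension step, with parts of linear size, fit into a pool of size 2^O(s²).
module Budget (L j K Q s : ℕ) (1≤s : 1 ≤ s) where
  K₁ m m′ M U Q₁ : ℕ
  -- The `+ 1` here and the `suc` in `M` give the strict inequalities of the two pigeonholes in
  -- `find-box`.
  K₁ = K * L + 1
  m  = K₁ * s
  m′ = K * s
  M  = suc ((L ^ m) ^ j * m′)
  U  = L * K₁ * j + K + 1
  -- The middle terms bound the exponents of the number of boxes and of the next pool; the `1` makes
  -- `pool-large` strict, and the last `U` leaves room for the `M` candidates.
  Q₁ = 1 + U * K + K₁ * K * j + L * j + Q + U

  private
    e-M e-D : ℕ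
    e-M = suc (L * m * j + m′)
    e-D = e-M * m′ + (m * m′ * j + L * j)

    M≤2^ : M ≤ 2 ^ e-M
    M≤2^ = 1+x≤2^1+e (L * m * j + m′) (*-≤2^ (L * m * j) m′ (^-≤2^ (L * m) j (^-≤2^ L m (n≤2^n L))) (n≤2^n m′))

    boxes≤2^ : boxes j m′ m M L ≤ 2 ^ e-D
    boxes≤2^ = *-≤2^ (e-M * m′) (m * m′ * j + L * j) (^-≤2^ e-M m′ M≤2^)
      (*-≤2^ (m * m′ * j) (L * j) (^-≤2^ (m * m′) j (^-≤2^ m m′ (n≤2^n m))) (^-≤2^ L j (n≤2^n L)))

    1≤s² : 1 ≤ s * s
    1≤s² = ℕ.*-mono-≤ 1≤s 1≤s

    x≤x*s² : ∀ x → x ≤ x * (s * s)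
    x≤x*s² x = subst (_≤ x * (s * s)) (ℕ.*-identityʳ x) (ℕ.*-monoʳ-≤ x 1≤s²)

    e-M≤ : e-M ≤ U * s
    e-M≤ = begin
      suc (L * (K₁ * s) * j + K * s) ≤⟨ ℕ.+-monoˡ-≤ _ 1≤s ⟩
      s + (L * (K₁ * s) * j + K * s) ≡⟨ regroup L K₁ j K s ⟩
      U * s ∎
      where
      open ℕ.≤-Reasoning
      regroup : ∀ L K₁ j K s → s + (L * (K₁ * s) * j + K * s) ≡ (L * K₁ * j + K + 1) * s
      regroup = solve-∀

    regroup : ∀ U K K₁ j L Q s →
              s * s + (U * s * (K * s) + (K₁ * s * (K * s) * j + L * j * (s * s)) + Q * (s * s))
                ≡ (1 + U * K + K₁ * K * j + L * j + Q) * (s * s)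
    regroup = solve-∀

    e-D≤ : suc (e-D + Q * (s * s)) ≤ Q₁ * (s * s)
    e-D≤ = begin
      1 + (e-M * m′ + (m * m′ * j + L * j) + Q * (s * s))
        ≤⟨ ℕ.+-mono-≤ 1≤s² (ℕ.+-monoˡ-≤ _ (ℕ.+-mono-≤ (ℕ.*-monoˡ-≤ m′ e-M≤) (ℕ.+-monoʳ-≤ (m * m′ * j) (x≤x*s² (L * j))))) ⟩
      s * s + (U * s * m′ + (m * m′ * j + L * j * (s * s)) + Q * (s * s))
        ≡⟨ regroup U K K₁ j L Q s ⟩
      (1 + U * K + K₁ * K * j + L * j + Q) * (s * s)
        ≤⟨ ℕ.*-monoˡ-≤ (s * s) (ℕ.m≤m+n (1 + U * K + K₁ * K * j + L * j + Q) U) ⟩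
      Q₁ * (s * s) ∎
      where open ℕ.≤-Reasoning

  many-cols : L * m′ < m
  many-cols = begin-strict
    L * (K * s)   ≡⟨ reorder L K s ⟩
    K * L * s     <⟨ ℕ.m<m+n (K * L * s) 1≤s ⟩
    K * L * s + s ≡⟨ collect (K * L) s ⟩
    K₁ * s        ∎
    where
    open ℕ.≤-Reasoning
    reorder : ∀ L K s → L * (K * s) ≡ K * L * s
    reorder = solve-∀
    collect : ∀ x s → x * s + s ≡ (x + 1) * s
    collect = solve-∀

  M≤pool : M ≤ 2 ^ (Q₁ * (s * s))
  M≤pool = ℕ.≤-trans M≤2^ (ℕ.^-monoʳ-≤ 2 (begin
    e-M          ≤⟨ e-M≤ ⟩
    U * s        ≤⟨ ℕ.*-monoʳ-≤ U (ℕ.m≤m*n s s {{ℕ.>-nonZero 1≤s}}) ⟩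
    U * (s * s)  ≤⟨ ℕ.*-monoˡ-≤ (s * s) (ℕ.m≤n+m U (1 + U * K + K₁ * K * j + L * j + Q)) ⟩
    Q₁ * (s * s) ∎))
    where open ℕ.≤-Reasoning

  pool-large : boxes j m′ m M L * 2 ^ (Q * (s * s)) < 2 ^ (Q₁ * (s * s))
  pool-large = ℕ.≤-trans (1+x≤2^1+e (e-D + Q * (s * s)) (*-≤2^ e-D (Q * (s * s)) boxes≤2^ ℕ.≤-refl))
    (ℕ.^-monoʳ-≤ 2 e-D≤)

BlowsUp : (R ℓ j K Q Q′ : ℕ) → Set
BlowsUp R ℓ j K Q Q′ = ∀ s → 1 ≤ s →
  ∀ (c : PartiteColouring R (2 ^ (Q′ * (s * s))) ℓ) (q : Fin j → Fin R) →
  Blowup c q (K * s) (2 ^ (Q * (s * s)))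

-- Since `extend` shrinks parts and pool, the induction hypothesis is called with the larger
-- constants `K₁` and `Q₁`.
blowup : ∀ {R ℓ} → Fin ℓ → ∀ j K Q → ∃[ Q′ ] BlowsUp R ℓ j K Q Q′
blowup c₀ zero K Q = Q , λ s _ c q → record
  { part = λ () ; part-inc = λ () ; pool = id ; pool-inc = id ; φ = λ _ ()
  ; pool-mono = λ { k t {()} } ; part-mono = λ { {()} } }
blowup {R} {ℓ} c₀ (suc j) K Q = Q′ , λ s 1≤s c q →
  let open Budget (ℓ ^ R) j K Q s 1≤s using (many-cols; M≤pool; pool-large) in
  extend c₀ (fromℕ< (ℕ.m^n>0 2 (Q * (s * s)))) ℕ.≤-refl many-cols M≤pool pool-large (build s 1≤s c (q ∘ suc))
  where
  -- `K₁` and `Q₁` do not depend on `s`, so reading them off at `s = 1` gives constants valid for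
  -- every `s`.
  open Budget (ℓ ^ R) j K Q 1 ℕ.≤-refl using (K₁; Q₁)
  IH = blowup {R} c₀ j K₁ Q₁
  Q′ = proj₁ IH
  build = proj₂ IH

-- Counting transversal triples

unique-length-≤ : ∀ {A : Set} {xs ys : List A} → Unique xs → All (_∈ᴸ ys) xs → length xs ≤ length ys
unique-length-≤ [] _ = z≤n
unique-length-≤ {xs = x ∷ xs} (x∉ ∷ xs!) (x∈ ∷ xs∈)
  with as , bs , refl ← ∈-∃++ x∈ = begin
  suc (length xs)             ≤⟨ s≤s (unique-length-≤ xs! (All.zipWith skip (x∉ , xs∈))) ⟩
  suc (length (as ++ bs))     ≡⟨ cong suc (length-++ as) ⟩
  suc (length as + length bs) ≡⟨ ℕ.+-suc (length as) (length bs) ⟨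
  length as + suc (length bs) ≡⟨ length-++ as ⟨
  length (as ++ x ∷ bs)       ∎
  where
  open ℕ.≤-Reasoning
  skip : ∀ {y} → (x ≢ y) × (y ∈ᴸ as ++ x ∷ bs) → y ∈ᴸ as ++ bs
  skip (x≢y , y∈) with ∈-++⁻ as y∈
  ... | inj₁ y∈as         = ∈-++⁺ˡ y∈as
  ... | inj₂ (here y≡x)   = contradiction (sym y≡x) x≢y
  ... | inj₂ (there y∈bs) = ∈-++⁺ʳ as y∈bs

unique-length-filter-≤ : ∀ {A : Set} {P : Pred A 0ℓ} (P? : Decidable P) {xs ys : List A} →
  Unique xs → All (λ x → x ∈ᴸ ys × P x) xs → length xs ≤ length (filter P? ys)
unique-length-filter-≤ P? xs! all = unique-length-≤ xs! (All.map (λ (x∈ , px) → ∈-filter⁺ P? x∈ px) all)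

module _ {A : Set} (p : A → ℕ) where

  similar? : ∀ x → Decidable (λ y → p x ≡ p y)
  similar? x y = p x ℕ.≟ p y

  Sparse : ℕ → List A → Set
  Sparse g []       = ⊤
  Sparse g (x ∷ xs) = length (filter (similar? x) xs) ≤ g × Sparse g xs

  pairs : List A → List (A × A)
  pairs []       = []
  pairs (x ∷ xs) = map (x ,_) (filter (¬? ∘ similar? x) xs) ++ pairs xs

  -- Only consecutive entries are compared; for a monotone `p`, such as the block number in
  -- `spread`, all three classes then differ.
  triples : List A → List (A × A × A)
  triples []       = []
  triples (x ∷ xs) = map (x ,_) (filter (¬? ∘ similar? x ∘ proj₁) (pairs xs)) ++ triples xs

  -- By Pascal's rule the head adds one pair per later entry, and sparsity loses at most `g` of
  -- these.
  length-pairs : ∀ {g} xs → Sparse g xs → length xs C 2 ≤ length (pairs xs) + g * length xs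
  length-pairs []       _ = z≤n
  length-pairs {g} (x ∷ xs) (≤g , sp) = begin
    suc n C 2                        ≡⟨ nCk+nC[k+1]≡[n+1]C[k+1] n 1 ⟨
    n C 1 + n C 2
      ≡⟨ cong (_+ n C 2) (trans (nC1≡n n) (length-filter-split (similar? x) xs)) ⟩
    (length (filter (similar? x) xs) + d) + n C 2
      ≤⟨ ℕ.+-mono-≤ (ℕ.+-monoˡ-≤ d ≤g) (length-pairs xs sp) ⟩
    (g + d) + (length (pairs xs) + g * n) ≡⟨ regroup g d (length (pairs xs)) n ⟩
    (d + length (pairs xs)) + g * suc n
      ≡⟨ cong (_+ g * suc n) (cong (_+ length (pairs xs)) (length-map (x ,_) diff)) ⟨
    (length (map (x ,_) diff) + length (pairs xs)) + g * suc n
      ≡⟨ cong (_+ g * suc n) (length-++ (map (x ,_) diff)) ⟨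
    length (pairs (x ∷ xs)) + g * suc n ∎
    where
    open ℕ.≤-Reasoning
    n = length xs
    diff = filter (¬? ∘ similar? x) xs
    d = length diff
    regroup : ∀ g d l n → (g + d) + (l + g * n) ≡ (d + l) + g * suc n
    regroup = solve-∀

  -- Each entry similar to `x` is the first member of at most `length xs` pairs.
  length-similar-pairs : ∀ x xs → length (filter (similar? x ∘ proj₁) (pairs xs)) ≤
    length (filter (similar? x) xs) * length xs
  length-similar-pairs x []       = z≤n
  length-similar-pairs x (y ∷ ys) = begin
    length (filter P? (map (y ,_) diff ++ pairs ys))
      ≡⟨ cong length (filter-++ P? (map (y ,_) diff) (pairs ys)) ⟩
    length (filter P? (map (y ,_) diff) ++ filter P? (pairs ys))
      ≡⟨ length-++ (filter P? (map (y ,_) diff)) ⟩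
    length (filter P? (map (y ,_) diff)) + length (filter P? (pairs ys))
      ≤⟨ ℕ.+-monoʳ-≤ (length (filter P? (map (y ,_) diff))) (length-similar-pairs x ys) ⟩
    length (filter P? (map (y ,_) diff)) + k * n ≤⟨ first ⟩
    length (filter (similar? x) (y ∷ ys)) * suc n ∎
    where
    open ℕ.≤-Reasoning
    P? : Decidable (λ (q : A × A) → p x ≡ p (proj₁ q))
    P? = similar? x ∘ proj₁
    n = length ys
    k = length (filter (similar? x) ys)
    diff = filter (¬? ∘ similar? y) ys
    first : length (filter P? (map (y ,_) diff)) + k * n ≤ length (filter (similar? x) (y ∷ ys)) * suc n
    first with similar? x y
    ... | yes x∼y = subst (λ v → length (filter P? (map (y ,_) diff)) + k * n ≤ length v * suc n)
      (sym (filter-accept (similar? x) x∼y)) (ℕ.+-mono-≤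
      (begin
        length (filter P? (map (y ,_) diff)) ≤⟨ length-filter P? (map (y ,_) diff) ⟩
        length (map (y ,_) diff) ≡⟨ length-map (y ,_) diff ⟩
        length diff ≤⟨ length-filter (¬? ∘ similar? y) ys ⟩
        n ≤⟨ ℕ.n≤1+n n ⟩
        suc n ∎)
      (ℕ.*-monoʳ-≤ k (ℕ.n≤1+n n)))
    ... | no x≁y = begin
      length (filter P? (map (y ,_) diff)) + k * n
        ≡⟨ cong (λ v → length v + k * n) (filter-none P? {xs = map (y ,_) diff} (All.map⁺ (All.universal (λ _ → x≁y) diff))) ⟩
      k * n
        ≤⟨ ℕ.*-monoʳ-≤ k (ℕ.n≤1+n n) ⟩
      k * suc n
        ≡⟨ cong (λ v → length v * suc n) (filter-reject (similar? x) x≁y) ⟨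
      length (filter (similar? x) (y ∷ ys)) * suc n ∎

  -- By Pascal's rule the head `x` adds `n C 2` triples. At most `g * n` are lost because their last
  -- two entries are similar, and at most `g * n` because the middle one is similar to `x`.
  length-triples : ∀ {g} xs → Sparse g xs →
    length xs C 3 ≤ length (triples xs) + 2 * g * (length xs * length xs)
  length-triples []       _ = z≤n
  length-triples {g} (x ∷ xs) (≤g , sp) = begin
    suc n C 3 ≡⟨ nCk+nC[k+1]≡[n+1]C[k+1] n 2 ⟨
    n C 2 + n C 3 ≤⟨ ℕ.+-mono-≤ (length-pairs xs sp) (length-triples xs sp) ⟩
    (length (pairs xs) + g * n) + (t + 2 * g * (n * n))
      ≡⟨ cong (λ v → (v + g * n) + (t + 2 * g * (n * n))) (length-filter-split (similar? x ∘ proj₁) (pairs xs)) ⟩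
    ((length (filter (similar? x ∘ proj₁) (pairs xs)) + d) + g * n) + (t + 2 * g * (n * n))
      ≤⟨ ℕ.+-monoˡ-≤ _ (ℕ.+-monoˡ-≤ (g * n) (ℕ.+-monoˡ-≤ d (ℕ.≤-trans (length-similar-pairs x xs) (ℕ.*-monoˡ-≤ n ≤g)))) ⟩
    ((g * n + d) + g * n) + (t + 2 * g * (n * n)) ≤⟨ ℕ.m≤m+n _ (2 * g * n + 2 * g) ⟩
    ((g * n + d) + g * n) + (t + 2 * g * (n * n)) + (2 * g * n + 2 * g) ≡⟨ regroup g n d t ⟩
    (d + t) + 2 * g * (suc n * suc n)
      ≡⟨ cong (λ v → v + t + 2 * g * (suc n * suc n)) (length-map (x ,_) diff) ⟨
    (length (map (x ,_) diff) + t) + 2 * g * (suc n * suc n)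
      ≡⟨ cong (_+ 2 * g * (suc n * suc n)) (length-++ (map (x ,_) diff)) ⟨
    length (triples (x ∷ xs)) + 2 * g * (suc n * suc n) ∎
    where
    open ℕ.≤-Reasoning
    n = length xs
    t = length (triples xs)
    diff = filter (¬? ∘ similar? x ∘ proj₁) (pairs xs)
    d = length diff
    regroup : ∀ g n d t → ((g * n + d) + g * n) + (t + 2 * g * (n * n)) + (2 * g * n + 2 * g) ≡
              (d + t) + 2 * g * (suc n * suc n)
    regroup = solve-∀

  pairs-proj₁ : ∀ {P : Pred A 0ℓ} {xs} → All P xs → All (P ∘ proj₁) (pairs xs)
  pairs-proj₁ []         = []
  pairs-proj₁ {xs = x ∷ xs} (px ∷ pxs) = All.++⁺ (All.map⁺ (All.universal (λ _ → px) _)) (pairs-proj₁ pxs)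

  triples-proj₁ : ∀ {P : Pred A 0ℓ} {xs} → All P xs → All (P ∘ proj₁) (triples xs)
  triples-proj₁ []         = []
  triples-proj₁ (px ∷ pxs) = All.++⁺ (All.map⁺ (All.universal (λ _ → px) _)) (triples-proj₁ pxs)

  pairs-unique : ∀ {xs} → Unique xs → Unique (pairs xs)
  pairs-unique []         = []
  pairs-unique (x∉ ∷ xs!) = AllPairs.++⁺ (Unique.map⁺ ,-injectiveʳ (Unique.filter⁺ _ xs!)) (pairs-unique xs!)
    (All.map⁺ (All.universal (λ _ → All.map (λ x≢ eq → x≢ (,-injectiveˡ eq)) (pairs-proj₁ x∉)) _))

  triples-unique : ∀ {xs} → Unique xs → Unique (triples xs)
  triples-unique []         = []
  triples-unique (x∉ ∷ xs!) = AllPairs.++⁺ (Unique.map⁺ ,-injectiveʳ (Unique.filter⁺ _ (pairs-unique xs!)))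
    (triples-unique xs!)
    (All.map⁺ (All.universal (λ _ → All.map (λ x≢ eq → x≢ (,-injectiveˡ eq)) (triples-proj₁ x∉)) _))

  pairs-all : ∀ {R : Rel A 0ℓ} {xs} → AllPairs R xs →
    All (λ (y , z) → R y z × p y ≢ p z) (pairs xs)
  pairs-all []       = []
  pairs-all {xs = x ∷ xs} (r ∷ rs) = All.++⁺
    (All.map⁺ (All.zip (All.filter⁺ (¬? ∘ similar? x) r , All.all-filter (¬? ∘ similar? x) xs)))
    (pairs-all rs)

  triples-all : ∀ {R : Rel A 0ℓ} {xs} → AllPairs R xs →
    All (λ (x , y , z) → (R x y × p x ≢ p y) × (R y z × p y ≢ p z)) (triples xs)
  triples-all []       = []
  triples-all {xs = x ∷ xs} (r ∷ rs) = All.++⁺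
    (All.map⁺ (All.zip (All.zip (All.filter⁺ P? (pairs-proj₁ r) , All.all-filter P? (pairs xs))
                       , All.filter⁺ P? (pairs-all rs))))
    (triples-all rs)
    where P? = ¬? ∘ similar? x ∘ proj₁

close⇒sparse : ∀ {s g} (p : Fin s → ℕ) → (∀ {x y} → x Fin.< y → p x ≡ p y → toℕ y ≤ toℕ x + g) →
  ∀ {xs} → AllPairs Fin._<_ xs → Sparse p g xs
close⇒sparse p close [] = tt
close⇒sparse {s} {g} p close {x ∷ xs} (x< ∷ xs<) = count , close⇒sparse p close xs<
  where
  same = filter (similar? p x) xs
  window = map (suc (toℕ x) +_) (upTo g)
  in-window : ∀ {y} → x Fin.< y × p x ≡ p y → toℕ y ∈ᴸ window
  in-window {y} (x<y , px≡py) = subst (_∈ᴸ window) (ℕ.m+[n∸m]≡n x<y)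
    (∈-map⁺ (suc (toℕ x) +_) (∈-upTo⁺ (ℕ.+-cancelˡ-< (suc (toℕ x)) _ _
      (subst (_< suc (toℕ x + g)) (sym (ℕ.m+[n∸m]≡n x<y)) (s≤s (close x<y px≡py))))))
  count : length same ≤ g
  count = begin
    length same ≡⟨ length-map toℕ same ⟨
    length (map toℕ same) ≤⟨ unique-length-≤
      (Unique.map⁺ Fin.toℕ-injective (Unique.filter⁺ (similar? p x) (AllPairs.map (λ x<y → Fin.<⇒≢ x<y) xs<)))
      (All.map⁺ (All.map in-window (All.zip (All.filter⁺ (similar? p x) x< , All.all-filter (similar? p x) xs)))) ⟩
    length window ≡⟨ length-map _ (upTo g) ⟩
    length (upTo g) ≡⟨ length-upTo g ⟩
    g ∎
    where open ℕ.≤-Reasoning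

-- Vertex lists as subsets

fromList : ∀ {N} → List (Fin N) → Subset N
fromList = foldr (λ x S → S [ x ]≔ inside) ⊥

∈-fromList : ∀ {N} {x : Fin N} {xs} → x ∈ᴸ xs → x ∈ fromList xs
∈-fromList {xs = y ∷ ys} (here refl) = []≔-updates (fromList ys) y
∈-fromList {x = x} {xs = y ∷ ys} (there x∈) with x Fin.≟ y
... | yes refl = []≔-updates (fromList ys) y
... | no  x≢y  = []≔-minimal (fromList ys) x y x≢y (∈-fromList x∈)

∉-fromList : ∀ {N} {x : Fin N} {xs} → All (x ≢_) xs → x ∉ fromList xs
∉-fromList [] = ∉⊥
∉-fromList {x = x} {y ∷ ys} (x≢y ∷ x∉) x∈ = ∉-fromList x∉
  (lookup⇒[]= x (fromList ys) (trans (sym (lookup∘update′ x≢y (fromList ys) inside)) ([]=⇒lookup x∈)))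

∣p[x]≔inside∣ : ∀ {N} (S : Subset N) x → x ∉ S → ∣ S [ x ]≔ inside ∣ ≡ suc ∣ S ∣
∣p[x]≔inside∣ (inside  ∷ S) zero    x∉ = contradiction here x∉
∣p[x]≔inside∣ (outside ∷ S) zero    x∉ = refl
∣p[x]≔inside∣ (inside  ∷ S) (suc x) x∉ = cong suc (∣p[x]≔inside∣ S x (x∉ ∘ there))
∣p[x]≔inside∣ (outside ∷ S) (suc x) x∉ = ∣p[x]≔inside∣ S x (x∉ ∘ there)

∣fromList∣ : ∀ {N} {xs : List (Fin N)} → Unique xs → ∣ fromList xs ∣ ≡ length xs
∣fromList∣ {N} [] = ∣⊥∣≡0 N
∣fromList∣ {xs = x ∷ xs} (x∉ ∷ xs!) = trans (∣p[x]≔inside∣ (fromList xs) x (∉-fromList x∉))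
  (cong suc (∣fromList∣ xs!))

-- Recovers by unification the local function through which triplesOf is defined.
triplesOf-shape : ∀ {N} (S : Subset N) →
  Σ (Fin N → Fin N → Fin N → List (Fin N × Fin N × Fin N)) λ keep →
  triplesOf S ≡
  concatMap (λ i → concatMap (λ j → concatMap (λ k → keep i j k) (allFin N)) (allFin N)) (allFin N)
triplesOf-shape S = _ , refl

∈-triplesOf : ∀ {N} (S : Subset N) {i j k} → i ∈ S → j ∈ S → k ∈ S → i Fin.< j → j Fin.< k →
  (i , j , k) ∈ᴸ triplesOf S
∈-triplesOf S {i} {j} {k} i∈ j∈ k∈ i<j j<k = in-range i (in-range j (in-range k kept))
  where
  in-range : ∀ {N} {B : Set} {f : Fin N → List B} {b} i → b ∈ᴸ f i → b ∈ᴸ concatMap f (allFin N)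
  in-range {f = f} i b∈ = ∈-concatMap⁺ f (lose (∈-allFin i) b∈)
  kept : (i , j , k) ∈ᴸ proj₁ (triplesOf-shape S) i j k
  kept with (i ∈? S) ×-dec (j ∈? S) ×-dec (k ∈? S) ×-dec (i Fin.<? j) ×-dec (j Fin.<? k)
  ... | yes _ = here refl
  ... | no ¬p = contradiction (i∈ , j∈ , k∈ , i<j , j<k) ¬p

module _ {N ℓ s g} (χ : TripleColouring N ℓ) (col : Fin ℓ) (w : Fin s → Fin N) (w-inc : Increasing w)
  (p : Fin s → ℕ) (close : ∀ {x y} → x Fin.< y → p x ≡ p y → toℕ y ≤ toℕ x + g)
  (mono : ∀ {x y z} → x Fin.< y → y Fin.< z → p x ≢ p y → p y ≢ p z → χ (w x) (w y) (w z) ≡ col) where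

  image : Subset N
  image = fromList (map w (allFin s))

  increasing⇒injective : ∀ {x y} → w x ≡ w y → x ≡ y
  increasing⇒injective {x} {y} eq with Fin.<-cmp x y
  ... | tri< x<y _ _ = contradiction eq (Fin.<⇒≢ (w-inc x<y))
  ... | tri≈ _ x≡y _ = x≡y
  ... | tri> _ _ y<x = contradiction (sym eq) (Fin.<⇒≢ (w-inc y<x))

  ∣image∣ : ∣ image ∣ ≡ s
  ∣image∣ = trans (∣fromList∣ (Unique.map⁺ increasing⇒injective (Unique.allFin⁺ s)))
    (trans (length-map w (allFin s)) (length-tabulate id))

  w∈image : ∀ x → w x ∈ image
  w∈image x = ∈-fromList (∈-map⁺ w (∈-allFin x))

  -- The transversal triples of positions map injectively to triples of `image` with colour `col`,
  -- and `length-triples` bounds how many triples are not transversal.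
  image-count : s C 3 ≤ countColour χ image col + 2 * g * (s * s)
  image-count = begin
    s C 3 ≡⟨ cong (_C 3) len ⟨
    length (allFin s) C 3
      ≤⟨ length-triples p (allFin s) (close⇒sparse p close (allFin-increasing s)) ⟩
    length ts + 2 * g * (length (allFin s) * length (allFin s))
      ≡⟨ cong₂ (λ u v → u + 2 * g * (v * v)) (sym (length-map w³ ts)) len ⟩
    length (map w³ ts) + 2 * g * (s * s)
      ≤⟨ ℕ.+-monoˡ-≤ (2 * g * (s * s)) (unique-length-filter-≤
       {P = λ (i , j , k) → χ i j k ≡ col} _ {ys = triplesOf image}
       (Unique.map⁺ w³-inj (triples-unique p (Unique.allFin⁺ s)))
       (All.map⁺ (All.map counted (triples-all p (allFin-increasing s))))) ⟩
    countColour χ image col + 2 * g * (s * s) ∎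
    where
    open ℕ.≤-Reasoning
    len = length-tabulate {n = s} id
    ts = triples p (allFin s)
    w³ : Fin s × Fin s × Fin s → Fin N × Fin N × Fin N
    w³ (x , y , z) = w x , w y , w z
    w³-inj : ∀ {t u} → w³ t ≡ w³ u → t ≡ u
    w³-inj eq = cong₂ _,_ (increasing⇒injective (cong proj₁ eq))
      (cong₂ _,_ (increasing⇒injective (cong (proj₁ ∘ proj₂) eq))
                 (increasing⇒injective (cong (proj₂ ∘ proj₂) eq)))
    counted : ∀ {t : Fin s × Fin s × Fin s} → let x , y , z = t in
      (x Fin.< y × p x ≢ p y) × (y Fin.< z × p y ≢ p z) →
      w³ t ∈ᴸ triplesOf image × χ (w x) (w y) (w z) ≡ col
    counted {x , y , z} ((x<y , x≁y) , (y<z , y≁z)) =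
      ∈-triplesOf image (w∈image x) (w∈image y) (w∈image z) (w-inc x<y) (w-inc y<z) ,
      mono x<y y<z x≁y y≁z

module _ {A : Set} {ℓ : ℕ} where

  Mono₁-lookup : ∀ {f c} (xs : List A) → Mono {ℓ = ℓ} 1 f c xs → ∀ i → f (lookup xs i) ≡ c
  Mono₁-lookup (x ∷ xs) (h , m) zero    = h
  Mono₁-lookup (x ∷ xs) (h , m) (suc i) = Mono₁-lookup xs m i

  Mono₂-lookup : ∀ {f c} (xs : List A) → Mono {ℓ = ℓ} 2 f c xs → ∀ {i j} → i Fin.< j →
    f (lookup xs i) (lookup xs j) ≡ c
  Mono₂-lookup (x ∷ xs) (h , m) {zero}  {suc j} _         = Mono₁-lookup xs h j
  Mono₂-lookup (x ∷ xs) (h , m) {suc i} {suc j} (s≤s i<j) = Mono₂-lookup xs m i<j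

  Mono₃-lookup : ∀ {f c} (xs : List A) → Mono {ℓ = ℓ} 3 f c xs → ∀ {i j k} → i Fin.< j → j Fin.< k →
    f (lookup xs i) (lookup xs j) (lookup xs k) ≡ c
  Mono₃-lookup (x ∷ xs) (h , m) {zero}  {suc j} {suc k} _         (s≤s j<k) = Mono₂-lookup xs h j<k
  Mono₃-lookup (x ∷ xs) (h , m) {suc i} {suc j} {suc k} (s≤s i<j) (s≤s j<k) = Mono₃-lookup xs m i<j j<k

-- Binomial estimates and density

2*[1+n]C2 : ∀ n → 2 * (suc n C 2) ≡ suc n * n
2*[1+n]C2 zero    = refl
2*[1+n]C2 (suc n) = begin
  2 * (suc (suc n) C 2)           ≡⟨ cong (2 *_) (nCk+nC[k+1]≡[n+1]C[k+1] (suc n) 1) ⟨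
  2 * (suc n C 1 + suc n C 2)     ≡⟨ cong (λ v → 2 * (v + suc n C 2)) (nC1≡n (suc n)) ⟩
  2 * (suc n + suc n C 2)         ≡⟨ ℕ.*-distribˡ-+ 2 (suc n) _ ⟩
  2 * suc n + 2 * (suc n C 2)     ≡⟨ cong (2 * suc n +_) (2*[1+n]C2 n) ⟩
  2 * suc n + suc n * n           ≡⟨ collect n ⟩
  suc (suc n) * suc n             ∎
  where
  open ≡-Reasoning
  collect : ∀ n → 2 * suc n + suc n * n ≡ suc (suc n) * suc n
  collect = solve-∀

6*[2+n]C3 : ∀ n → 6 * (suc (suc n) C 3) ≡ suc (suc n) * suc n * n
6*[2+n]C3 zero    = refl
6*[2+n]C3 (suc n) = begin
  6 * (suc (suc (suc n)) C 3)
    ≡⟨ cong (6 *_) (nCk+nC[k+1]≡[n+1]C[k+1] (suc (suc n)) 2) ⟨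
  6 * (suc (suc n) C 2 + suc (suc n) C 3)     ≡⟨ distrib (suc (suc n) C 2) (suc (suc n) C 3) ⟩
  3 * (2 * (suc (suc n) C 2)) + 6 * (suc (suc n) C 3)
    ≡⟨ cong₂ (λ u v → 3 * u + v) (2*[1+n]C2 (suc n)) (6*[2+n]C3 n) ⟩
  3 * (suc (suc n) * suc n) + suc (suc n) * suc n * n ≡⟨ collect n ⟩
  suc (suc (suc n)) * suc (suc n) * suc n     ∎
  where
  open ≡-Reasoning
  distrib : ∀ x y → 6 * (x + y) ≡ 3 * (2 * x) + 6 * y
  distrib = solve-∀
  collect : ∀ n → 3 * (suc (suc n) * suc n) + suc (suc n) * suc n * n ≡
              suc (suc (suc n)) * suc (suc n) * suc n
  collect = solve-∀

-- For `s ≥ 3` the factors `s - 1` and `s - 2` are at least `2s/3` and `s/3`, with equality at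
-- `s = 3`.
s³≤27*sC3 : ∀ n → let s = 3 + n in s * (s * s) ≤ 27 * (s C 3)
s³≤27*sC3 n = ℕ.*-cancelˡ-≤ 6 (begin
  6 * (s * (s * s))                      ≤⟨ ℕ.m≤m+n _ (s * (45 * n + 21 * (n * n))) ⟩
  6 * (s * (s * s)) + s * (45 * n + 21 * (n * n)) ≡⟨ expand n ⟩
  27 * (s * suc (suc n) * suc n)         ≡⟨ cong (27 *_) (6*[2+n]C3 (suc n)) ⟨
  27 * (6 * (s C 3))                     ≡⟨ swap (s C 3) ⟩
  6 * (27 * (s C 3))                     ∎)
  where
  open ℕ.≤-Reasoning
  s = 3 + n
  expand : ∀ n → 6 * ((3 + n) * ((3 + n) * (3 + n))) + (3 + n) * (45 * n + 21 * (n * n)) ≡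
             27 * ((3 + n) * suc (suc n) * suc n)
  expand = solve-∀
  swap : ∀ x → 27 * (6 * x) ≡ 6 * (27 * x)
  swap = solve-∀

-- 54 = 2 · 27, where 27 comes from s³ ≤ 27 (s C 3) for s ≥ 3; for s < 3 there are no triples.
dense-enough : ∀ a b s g count → 1 ≤ a → g * (54 * b) ≤ s →
  s C 3 ≤ count + 2 * g * (s * s) → (b ∸ a) * (s C 3) ≤ b * count
dense-enough a b 0 g count _ _ _ = subst (_≤ b * count) (sym (ℕ.*-zeroʳ (b ∸ a))) z≤n
dense-enough a b 1 g count _ _ _ = subst (_≤ b * count) (sym (ℕ.*-zeroʳ (b ∸ a))) z≤n
dense-enough a b 2 g count _ _ _ = subst (_≤ b * count) (sym (ℕ.*-zeroʳ (b ∸ a))) z≤n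
dense-enough a b s@(suc (suc (suc n))) g count 1≤a g-small few-bad = begin
  (b ∸ a) * (s C 3)                  ≡⟨ ℕ.*-distribʳ-∸ (s C 3) b a ⟩
  b * (s C 3) ∸ a * (s C 3)          ≤⟨ ℕ.m≤n+o⇒m∸n≤o _ (a * (s C 3)) total ⟩
  b * count                          ∎
  where
  open ℕ.≤-Reasoning
  -- The loss is at most a `1/b` fraction of all triples, which is within `a/b` because `1 ≤ a`.
  bad : 27 * (b * (2 * g * (s * s))) ≤ 27 * (s C 3)
  bad = begin
    27 * (b * (2 * g * (s * s)))     ≡⟨ regroup b g (s * s) ⟩
    g * (54 * b) * (s * s)           ≤⟨ ℕ.*-monoˡ-≤ (s * s) g-small ⟩
    s * (s * s)                      ≤⟨ s³≤27*sC3 n ⟩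
    27 * (s C 3)                     ∎
    where
    regroup : ∀ b g t → 27 * (b * (2 * g * t)) ≡ g * (54 * b) * t
    regroup = solve-∀
  total : b * (s C 3) ≤ a * (s C 3) + b * count
  total = begin
    b * (s C 3)                            ≤⟨ ℕ.*-monoʳ-≤ b few-bad ⟩
    b * (count + 2 * g * (s * s))          ≡⟨ ℕ.*-distribˡ-+ b count _ ⟩
    b * count + b * (2 * g * (s * s))      ≤⟨ ℕ.+-monoʳ-≤ (b * count) (ℕ.*-cancelˡ-≤ 27 bad) ⟩
    b * count + s C 3
      ≤⟨ ℕ.+-monoʳ-≤ (b * count) (ℕ.m≤n*m (s C 3) a {{ℕ.>-nonZero 1≤a}}) ⟩
    b * count + a * (s C 3)                ≡⟨ ℕ.+-comm (b * count) _ ⟩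
    a * (s C 3) + b * count                ∎

-- Spreading vertices in blocks

m<n*[1+m/n] : ∀ m n .{{_ : NonZero n}} → m < n * suc (m / n)
m<n*[1+m/n] m n = begin-strict
  m                     ≡⟨ m≡m%n+[m/n]*n m n ⟩
  m % n + m / n * n     <⟨ ℕ.+-monoˡ-< (m / n * n) (m%n<n m n) ⟩
  n + m / n * n         ≡⟨ ℕ.*-comm (suc (m / n)) n ⟩
  n * suc (m / n)       ∎
  where open ℕ.≤-Reasoning

same-quotient⇒close : ∀ x y g → x / suc g ≡ y / suc g → y ≤ x + g
same-quotient⇒close x y g eq = ℕ.s≤s⁻¹ (begin-strict
  y                                     <⟨ m<n*[1+m/n] y (suc g) ⟩
  suc g * suc (y / suc g)               ≡⟨ cong (λ v → suc g * suc v) eq ⟨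
  suc g * suc (x / suc g)               ≡⟨ ℕ.*-comm (suc g) _ ⟩
  suc g + x / suc g * suc g             ≤⟨ ℕ.+-monoʳ-≤ (suc g) (m/n*n≤m x (suc g)) ⟩
  suc g + x                             ≡⟨ cong suc (ℕ.+-comm g x) ⟩
  suc (x + g)                           ∎)
  where open ℕ.≤-Reasoning

combine-monoʳ-< : ∀ {m n} (i : Fin m) {x y : Fin n} → x Fin.< y → combine i x Fin.< combine i y
combine-monoʳ-< {n = n} i {x} {y} x<y = subst₂ _<_
  (sym (Fin.toℕ-combine i x)) (sym (Fin.toℕ-combine i y))
  (ℕ.+-monoʳ-< (n * toℕ i) x<y)

-- Spread s vertices over r of the R parts as evenly as possible, so that only
-- triples with two vertices within distance s / r can fail to be transversal.
module _ {R n N ℓ} (χ : TripleColouring N ℓ) (Rn≤N : R * n ≤ N) where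

  vertex : Fin R → Fin n → Fin N
  vertex i x = inject≤ (combine i x) Rn≤N

  partite : PartiteColouring R n ℓ
  partite i x j y k z = χ (vertex i x) (vertex j y) (vertex k z)

  spread : ∀ {s r P col ys} .{{_ : NonZero r}} (B : Blowup partite id s P) →
    ys ⊆ allFin R → r ≤ length ys →
    Mono 3 (Blowup.φ B) col ys →
    ∃[ S ] (∣ S ∣ ≡ s × s C 3 ≤ countColour χ S col + 2 * (s / r) * (s * s))
  spread {s} {r} {col = col} {ys} B ys⊆ r≤ mono =
    image χ col w w-inc block close w-mono ,
    ∣image∣ χ col w w-inc block close w-mono ,
    image-count χ col w w-inc block close w-mono
    where
    open Blowup B
    g = s / r
    block : Fin s → ℕ
    -- Blocks have length `suc g`: then `s < r * suc g` gives at most `r` blocks, and positions in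
    -- one block differ by at most `g`.
    block e = toℕ e / suc g
    block<r : ∀ e → block e < r
    block<r e = m<n*o⇒m/o<n (ℕ.<-trans (Fin.toℕ<n e) (m<n*[1+m/n] s r))
    index : Fin s → Fin (length ys)
    index e = fromℕ< (ℕ.<-≤-trans (block<r e) r≤)
    toℕ-index : ∀ e → toℕ (index e) ≡ block e
    toℕ-index e = Fin.toℕ-fromℕ< _
    index-< : ∀ {x y} → x Fin.< y → block x ≢ block y → index x Fin.< index y
    index-< {x} {y} x<y x≁y = subst₂ _<_ (sym (toℕ-index x)) (sym (toℕ-index y))
      (ℕ.≤∧≢⇒< (/-monoˡ-≤ (suc g) (ℕ.<⇒≤ x<y)) x≁y)
    ρ : Fin s → Fin R
    ρ e = lookup ys (index e)
    ρ-< : ∀ {x y} → x Fin.< y → block x ≢ block y → ρ x Fin.< ρ y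
    ρ-< x<y x≁y = AllPairs-lookup (AllPairs-resp-⊆ ys⊆ (allFin-increasing R)) (index-< x<y x≁y)
    w : Fin s → Fin N
    -- Position `e` takes the vertex numbered `e` of its part, so the order inside a part is that of
    -- the positions.
    w e = vertex (ρ e) (part (ρ e) e)
    w-inc : Increasing w
    w-inc {x} {y} x<y with block x ℕ.≟ block y
    ... | no  x≁y = inject≤-increasing Rn≤N (Fin.combine-monoˡ-< _ _ (ρ-< x<y x≁y))
    ... | yes x∼y = inject≤-increasing Rn≤N
      (subst (λ i → combine (ρ x) (part (ρ x) x) Fin.< combine i (part i y))
        (cong (lookup ys) (Fin.toℕ-injective (trans (toℕ-index x) (trans x∼y (sym (toℕ-index y))))))
        (combine-monoʳ-< (ρ x) (part-inc (ρ x) x<y)))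
    close : ∀ {x y} → x Fin.< y → block x ≡ block y → toℕ y ≤ toℕ x + g
    close {x} {y} _ = same-quotient⇒close (toℕ x) (toℕ y) g
    w-mono : ∀ {x y z} → x Fin.< y → y Fin.< z → block x ≢ block y → block y ≢ block z →
      χ (w x) (w y) (w z) ≡ col
    w-mono x<y y<z x≁y y≁z = trans (part-mono (ρ-< x<y x≁y) (ρ-< y<z y≁z) _ _ _)
      (Mono₃-lookup ys mono (index-< x<y x≁y) (index-< y<z y≁z))

-- Assembling the constants

parts-fit : ∀ R Q N s → 1 ≤ s → (let q = suc (R + Q)) →
  2 ^ (s * s * (q * q)) ≤ N → R * 2 ^ (Q * (s * s)) ≤ N
parts-fit R Q N s 1≤s large = begin
  R * 2 ^ (Q * (s * s))    ≤⟨ *-≤2^ R (Q * (s * s)) (n≤2^n R) ℕ.≤-refl ⟩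
  2 ^ (R + Q * (s * s))    ≤⟨ ℕ.^-monoʳ-≤ 2 exponent ⟩
  2 ^ (s * s * (q * q))    ≤⟨ large ⟩
  N                        ∎
  where
  open ℕ.≤-Reasoning
  q = suc (R + Q)
  exponent : R + Q * (s * s) ≤ s * s * (q * q)
  exponent = begin
    R + Q * (s * s)
      ≤⟨ ℕ.+-monoˡ-≤ _ (ℕ.m≤m*n R (s * s) {{ℕ.>-nonZero (ℕ.*-mono-≤ 1≤s 1≤s)}}) ⟩
    R * (s * s) + Q * (s * s)     ≡⟨ ℕ.*-distribʳ-+ (s * s) R Q ⟨
    (R + Q) * (s * s)
      ≤⟨ ℕ.*-monoˡ-≤ (s * s) (ℕ.≤-trans (ℕ.n≤1+n (R + Q)) (ℕ.m≤m*n q q)) ⟩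
    q * q * (s * s)               ≡⟨ ℕ.*-comm (q * q) _ ⟩
    s * s * (q * q)               ∎

AlmostMono : (ℓ r q : ℕ) .{{_ : NonZero r}} → Set
AlmostMono ℓ r q = ∀ N (χ : TripleColouring N ℓ) s → 1 ≤ s → 2 ^ (s * s * (q * q)) ≤ N →
  ∃[ S ] ∃[ col ] (∣ S ∣ ≡ s × s C 3 ≤ countColour χ S col + 2 * (s / r) * (s * s))

-- All `R` parts are treated, keeping `s` vertices each and a pool of one element. Then `φ` is a
-- colouring of triples of parts, to which Ramsey's theorem applies.
ramsey∧blowsUp⇒almostMono : ∀ {R Q ℓ} r .{{_ : NonZero r}} →
  IsRamsey ℓ 3 r R → BlowsUp R ℓ R 1 0 Q → AlmostMono ℓ r (suc (R + Q))
ramsey∧blowsUp⇒almostMono {R} {Q} r ramsey-R blowup-R N χ s 1≤s large =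
  let col , ys , ys⊆ , r≤ , mono = ramsey-R (Blowup.φ B) (allFin R)
                                     (ℕ.≤-reflexive (sym (length-tabulate {n = R} id)))
      S , size , count = spread χ fits B ys⊆ r≤ mono
  in S , col , size , count
  where
  fits : R * 2 ^ (Q * (s * s)) ≤ N
  fits = parts-fit R Q N s 1≤s large
  B : Blowup (partite χ fits) id s 1
  B = subst (λ m → Blowup (partite χ fits) id m 1) (ℕ.*-identityˡ s)
    (blowup-R s 1≤s (partite χ fits) id)

almostMono : ∀ {ℓ} → Fin ℓ → ∀ r .{{_ : NonZero r}} → ∃[ t ] AlmostMono ℓ r (suc t)
almostMono {ℓ} c₀ r = from-ramsey (ramsey ℓ 3 r)
  where
  from-blowup : ∀ {R} → IsRamsey ℓ 3 r R → ∃[ Q ] BlowsUp R ℓ R 1 0 Q → ∃[ t ] AlmostMono ℓ r (suc t)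
  from-blowup {R} ramsey-R (Q , blowup-R) = R + Q , ramsey∧blowsUp⇒almostMono r ramsey-R blowup-R
  from-ramsey : ∃[ R ] IsRamsey ℓ 3 r R → ∃[ t ] AlmostMono ℓ r (suc t)
  from-ramsey (R , ramsey-R) = from-blowup ramsey-R (blowup c₀ R 1 0)

-- Here `ε = a/b` and `c = p/q`; squared and exponentiated, the two bounds on `N ^ (p * p)` say that
-- `s` is the floor of `c √(log N)`.
theorem1 : (a b : ℕ) → 1 ≤ a → 1 ≤ b → (ℓ : ℕ) → 1 ≤ ℓ →
    ∃[ p ] ∃[ q ] (1 ≤ p × 1 ≤ q ×
    ((N : ℕ) (χ : TripleColouring N ℓ) (s : ℕ) →
    2 ^ (s * s * (q * q)) ≤ N ^ (p * p) →
    N ^ (p * p) < 2 ^ ((s + 1) * (s + 1) * (q * q)) →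
    ∃[ S ] ∃[ col ] (∣ S ∣ ≡ s ×
    (b ∸ a) * (s C 3) ≤ b * countColour χ S col)))
theorem1 a b 1≤a 1≤b ℓ 1≤ℓ = conclude (almostMono c₀ (54 * b))
  where
  c₀ : Fin ℓ
  c₀ = fromℕ< 1≤ℓ
  instance
    54b≢0 : NonZero (54 * b)
    54b≢0 = ℕ.m*n≢0 54 b {{_}} {{ℕ.>-nonZero 1≤b}}
  conclude : ∃[ t ] AlmostMono ℓ (54 * b) (suc t) →
    ∃[ p ] ∃[ q ] (1 ≤ p × 1 ≤ q × ((N : ℕ) (χ : TripleColouring N ℓ) (s : ℕ) →
      2 ^ (s * s * (q * q)) ≤ N ^ (p * p) → N ^ (p * p) < 2 ^ ((s + 1) * (s + 1) * (q * q)) →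
      ∃[ S ] ∃[ col ] (∣ S ∣ ≡ s × (b ∸ a) * (s C 3) ≤ b * countColour χ S col)))
  -- The constant is `c = 1 / suc t`. Spreading over `54 * b` parts makes `g = s / (54 * b)` as
  -- small as `dense-enough` asks.
  conclude (t , find) = 1 , suc t , s≤s z≤n , s≤s z≤n , λ where
    N χ zero _ _ → ⊥ , c₀ , ∣⊥∣≡0 N , ℕ.≤-trans (ℕ.≤-reflexive (ℕ.*-zeroʳ (b ∸ a))) z≤n
    N χ s@(suc _) large _ →
      let S , col , size , count = find N χ s (s≤s z≤n) (subst (_ ≤_) (ℕ.^-identityʳ N) large)
      in S , col , size , dense-enough a b s (s / (54 * b)) _ 1≤a (m/n*n≤m s (54 * b)) count
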